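{- Let $\mathrm{Spec}\subseteq\mathcal{E}^\ast$ be any specification and let $\mathit{seqCons}$ denote the formula $\neg D_{\mathrm{Threads}}(\neg\,\mathit{correct})$. Then for every $E\in\mathcal{E}^\infty$, $$(E,\mathrm{len}(E))\models(\mathit{seqCons}\leftrightarrow D_{\mathrm{Threads}}(\mathit{seqCons}))\wedge(\neg\mathit{seqCons}\leftrightarrow D_{\mathrm{Threads}}(\neg\mathit{seqCons})).$$
   Context: Let $\mathrm{Threads}$ be a set, $\mathit{env}\notin\mathrm{Threads}$ an extra element (the environment), and $\mathcal{A}$ a set of actions. The set of events is $\mathcal{E}=(\mathrm{Threads}\uplus\{\mathit{env}\})\times\mathcal{A}$. $\mathcal{E}^\ast$ and $\mathcal{E}^\omega$ are the sets of finite and of infinite sequences over $\mathcal{E}$, and $\mathcal{E}^\infty=\mathcal{E}^\ast\uplus\mathcal{E}^\omega$. $\mathrm{len}(E)\in\mathbb{N}\uplus\{\omega\}$ is the length of $E$ ($\omega$ for infinite sequences). Positions start at $1$; $E\downharpoonright i$ is the prefix of $E$ up to and including position $i$ (all of $E$ if $i\ge\mathrm{len}(E)$, in particular if $i=\omega$). For $t\in\mathrm{Threads}$, $E\downarrow t$ is the sequence obtained from $E$ by erasing all events not of the form $(t,\mathit{act})$ with $\mathit{act}\in\mathcal{A}$. For $(E,i),(E',i')\in\mathcal{E}^\infty\times(\mathbb{N}\uplus\{\omega\})$, $(E,i)\sim_t(E',i')$ iff $(E\downharpoonright i)\downarrow t=(E'\downharpoonright i')\downarrow t$; $\sim_{\mathrm{Threads}}=\bigcap_{t\in\mathrm{Threads}}\sim_t$.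 Satisfaction for $(E,i)\in\mathcal{E}^\infty\times(\mathbb{N}\uplus\{\omega\})$: $(E,i)\models\mathit{correct}$ iff $E\downharpoonright i\in\mathrm{Spec}$; the connectives $\neg,\wedge,\leftrightarrow$ have their usual pointwise meaning; $(E,i)\models D_{\mathrm{Threads}}(\varphi)$ iff $(E',i')\models\varphi$ for all $(E',i')\in\mathcal{E}^\infty\times(\mathbb{N}\uplus\{\omega\})$ with $(E,i)\sim_{\mathrm{Threads}}(E',i')$. -}

module Defs where

open import Data.Empty using (⊥)
open import Data.Fin using (toℕ)
open import Data.List using (List; []; _∷_; length; lookup; take; applyUpTo)
open import Data.Nat using (ℕ; suc)
open import Data.Product using (_×_; _,_; ∃-syntax)
open import Data.Sum using (_⊎_; inj₁; inj₂)
open import Data.Unit using (⊤; tt)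
open import Function.Bundles using (_⇔_)
open import Level using (0ℓ)
open import Relation.Binary.PropositionalEquality using (_≡_)
open import Relation.Nullary using (¬_)
open import Relation.Unary using (Pred; _≐_)

data ℕ∪ω : Set where
  fin : ℕ → ℕ∪ω
  ω   : ℕ∪ω

-- X ^∞ = X* ⊎ X^ω.  Positions start at 1, so an infinite sequence f
-- has f k at position suc k.
_^∞ : Set → Set
X ^∞ = List X ⊎ (ℕ → X)

len : {X : Set} → X ^∞ → ℕ∪ω
len (inj₁ xs) = fin (length xs)
len (inj₂ _)  = ω

prefix : {X : Set} → X ^∞ → ℕ → List X
prefix (inj₁ xs) i = take i xs
prefix (inj₂ f)  i = applyUpTo f i

infixl 25 _⇂_
_⇂_ : {X : Set} → X ^∞ → ℕ∪ω → X ^∞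
E ⇂ fin i = inj₁ (prefix E i)
E ⇂ ω     = E

Graph : Set → Set₁
Graph X = Pred (ℕ × X) 0ℓ

graph : {X : Set} → List X → Graph X
graph xs (n , x) = ∃[ k ] (suc (toℕ k) ≡ n × lookup xs k ≡ x)

Event : Set → Set → Set
Event Threads 𝒜 = (Threads ⊎ ⊤) × 𝒜

pattern env = inj₂ tt

data Formula : Set where
  correct  : Formula
  ¬′_      : Formula → Formula
  _∧′_     : Formula → Formula → Formula
  _↔′_     : Formula → Formula → Formula
  DThreads : Formula → Formula

infix  9 ¬′_
infixr 7 _∧′_
infix  6 _↔′_

seqCons : Formula
seqCons = ¬′ DThreads (¬′ correct)

module _ {Threads 𝒜 : Set} where

  _by_ : Event Threads 𝒜 → Threads → Set
  e by t = ∃[ act ] e ≡ (inj₁ t , act)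

  -- Erases t xs ys: erasing from xs all events not by t yields ys.
  -- A relation rather than a filter, since equality on Threads is not
  -- assumed to be decidable.
  data Erases (t : Threads) : (xs ys : List (Event Threads 𝒜)) → Set where
    []   : Erases t [] []
    keep : ∀ {e xs ys} → e by t → Erases t xs ys → Erases t (e ∷ xs) (e ∷ ys)
    drop : ∀ {e xs ys} → ¬ (e by t) → Erases t xs ys → Erases t (e ∷ xs) ys

  -- Whether an infinite E contains finitely or infinitely many events by t
  -- is undecidable, so E ↓ t cannot be computed as an element of
  -- Event Threads 𝒜 ^∞.  It is given by its graph instead: (n , e) belongs
  -- to it when e is at position n in the erasure of some finite prefix of E.
  -- Equality of such sequences is extensional equality _≐_ of graphs.
  infixl 20 _↓_
  _↓_ : Event Threads 𝒜 ^∞ → Threads → Graph (Event Threads 𝒜)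
  (E ↓ t) p = ∃[ j ] ∃[ ys ] (Erases t (prefix E j) ys × graph ys p)

  Point : Set
  Point = Event Threads 𝒜 ^∞ × ℕ∪ω

  infix 4 _∼[_]_ _∼Threads_
  _∼[_]_ : Point → Threads → Point → Set
  (E , i) ∼[ t ] (E′ , i′) = (E ⇂ i) ↓ t ≐ (E′ ⇂ i′) ↓ t

  _∼Threads_ : Point → Point → Set
  P ∼Threads Q = ∀ t → P ∼[ t ] Q

  -- Spec contains finite sequences only.
  _∈Spec_ : Event Threads 𝒜 ^∞ → Pred (List (Event Threads 𝒜)) 0ℓ → Set
  inj₁ xs ∈Spec Spec = Spec xs
  inj₂ _  ∈Spec Spec = ⊥

  infix 3 _⊨[_]_
  _⊨[_]_ : Point → Pred (List (Event Threads 𝒜)) 0ℓ → Formula → Set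
  (E , i) ⊨[ Spec ] correct    = (E ⇂ i) ∈Spec Spec
  P ⊨[ Spec ] (¬′ φ)           = ¬ (P ⊨[ Spec ] φ)
  P ⊨[ Spec ] (φ ∧′ ψ)         = (P ⊨[ Spec ] φ) × (P ⊨[ Spec ] ψ)
  P ⊨[ Spec ] (φ ↔′ ψ)         = (P ⊨[ Spec ] φ) ⇔ (P ⊨[ Spec ] ψ)
  P ⊨[ Spec ] (DThreads φ)     = ∀ Q → P ∼Threads Q → Q ⊨[ Spec ] φ

{-# OPTIONS --safe #-}
module Submission where

open import Data.List using (List)
open import Data.Product using (_,_)
open import Function using (_∘_)
open import Function.Bundles using (_⇔_; mk⇔)
open import Level using (0ℓ)
open import Relation.Unary using (Pred)
open import Relation.Unary.Properties using (≐-refl; ≐-sym; ≐-trans)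
open import Defs

-- ∼Threads is an equivalence relation, so the truth value of DThreads φ is
-- constant on its classes, and hence so are those of seqCons and ¬′ seqCons.
-- A formula constant on classes holds at a point iff it holds throughout
-- the class of that point.

module _ {Threads 𝒜 : Set} where

  ∼Threads-refl : (P : Point {Threads} {𝒜}) → P ∼Threads P
  ∼Threads-refl P t = ≐-refl

  ∼Threads-sym : (P Q : Point {Threads} {𝒜}) → P ∼Threads Q → Q ∼Threads P
  ∼Threads-sym P Q P∼Q t = ≐-sym (P∼Q t)

  ∼Threads-trans : (P Q R : Point {Threads} {𝒜}) →
    P ∼Threads Q → Q ∼Threads R → P ∼Threads R
  ∼Threads-trans P Q R P∼Q Q∼R t = ≐-trans (P∼Q t) (Q∼R t)

  module _ (Spec : Pred (List (Event Threads 𝒜)) 0ℓ) where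

    -- One implication suffices here: since `∼Threads` is symmetric, swapping `P` and `Q` yields the
    -- converse.
    Invariant : Formula → Set
    Invariant φ = ∀ P Q → P ∼Threads Q → P ⊨[ Spec ] φ → Q ⊨[ Spec ] φ

    -- By transitivity, every point related to `Q` is among those that `DThreads φ` at `P` already
    -- covers; `φ` itself may vary within a class.
    DThreads-invariant : ∀ φ → Invariant (DThreads φ)
    DThreads-invariant φ P Q P∼Q Dφ R Q∼R = Dφ R (∼Threads-trans P Q R P∼Q Q∼R)

    -- Contraposition: `φ` has to be carried back from `Q` to `P`, which is where symmetry enters.
    ¬′-invariant : ∀ φ → Invariant φ → Invariant (¬′ φ)
    ¬′-invariant φ inv P Q P∼Q ¬φ = ¬φ ∘ inv Q P (∼Threads-sym P Q P∼Q)

    invariant⇒⇔DThreads : ∀ φ → Invariant φ →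
      ∀ P → (P ⊨[ Spec ] φ) ⇔ (P ⊨[ Spec ] DThreads φ)
    invariant⇒⇔DThreads φ inv P =
      mk⇔ (λ Pφ Q P∼Q → inv P Q P∼Q Pφ) (λ Dφ → Dφ P (∼Threads-refl P))

    seqCons-invariant : Invariant seqCons
    seqCons-invariant =
      ¬′-invariant (DThreads (¬′ correct)) (DThreads-invariant (¬′ correct))

theorem4 : (Threads 𝒜 : Set) (Spec : Pred (List (Event Threads 𝒜)) 0ℓ) (E : Event Threads 𝒜 ^∞) →
    (E , len E) ⊨[ Spec ] ((seqCons ↔′ DThreads seqCons) ∧′ (¬′ seqCons ↔′ DThreads (¬′ seqCons)))
theorem4 Threads 𝒜 Spec E =
    invariant⇒⇔DThreads Spec seqCons (seqCons-invariant Spec) (E , len E)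
  , invariant⇒⇔DThreads Spec (¬′ seqCons)
      (¬′-invariant Spec seqCons (seqCons-invariant Spec)) (E , len E)
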